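{- Let $\mathbf{M}=\langle M,\oplus,{}',0\rangle$ be an MV-algebra. Define, for $x,y\in M$, $x+y=(x'\oplus y)'\oplus y$, $x\cdot y=(x'\oplus y')'$, $\alpha(x)=x'$, and $1=0'$. Then the structure $\mathbf{R}(\mathbf{M})=\langle M,+,\cdot,\alpha,0,1\rangle$ is a Łukasiewicz semiring.
   Context: An MV-algebra is an algebra $\langle M,\oplus,{}',0\rangle$ of type $\langle 2,1,0\rangle$ such that $\langle M,\oplus,0\rangle$ is a commutative monoid, $x''=x$, $x\oplus 0'=0'$, and $(x'\oplus y)'\oplus y=(y'\oplus x)'\oplus x$. A semiring is an algebra $\langle R,+,\cdot,0,1\rangle$ such that $\langle R,+,0\rangle$ is a commutative monoid, $\langle R,\cdot,1\rangle$ is a monoid, both distributive laws $(x+y)\cdot z=(x\cdot z)+(y\cdot z)$ and $x\cdot(y+z)=(x\cdot y)+(x\cdot z)$ hold, and $x\cdot 0=0\cdot x=0$. If $x+x=x$ holds (idempotency), then $x\le y$ iff $x+y=y$ defines a partial order. A Łukasiewicz semiring is an idempotent semiring together with a map $\alpha:R\to R$ such that $\alpha(\alpha(x))=x$; $x\le y$ implies $\alpha(y)\le\alpha(x)$; and $\alpha(x\cdot\alpha(y))\cdot\alpha(y)=\alpha(y\cdot\alpha(x))\cdot\alpha(x)$ for all $x,y$. -}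

module Defs where

open import Algebra.Core using (Op₁; Op₂)
import Algebra.Definitions as AlgebraicDefinitions
import Algebra.Structures as AlgebraicStructures
open import Level using (Level; _⊔_; suc)
open import Relation.Binary.Core using (Rel)
open import Relation.Binary.Definitions using (Antitonic₁)

private
  variable
    a ℓ : Level

module _ {A : Set a} (_≈_ : Rel A ℓ) where

  open AlgebraicDefinitions _≈_
  open AlgebraicStructures _≈_

  record IsMVAlgebra (_⊕_ : Op₂ A) (_′ : Op₁ A) (0# : A) : Set (a ⊔ ℓ) where
    field
      ⊕-isCommutativeMonoid : IsCommutativeMonoid _⊕_ 0#
      ′-cong                : Congruent₁ _′
      ′-involutive          : Involutive _′
      ⊕-zeroʳ               : RightZero (0# ′) _⊕_
      łukasiewicz           : ∀ x y →
        ((((x ′) ⊕ y) ′) ⊕ y) ≈ ((((y ′) ⊕ x) ′) ⊕ x)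

    open IsCommutativeMonoid ⊕-isCommutativeMonoid public

  record IsŁukasiewiczSemiring (_+_ _·_ : Op₂ A) (α : Op₁ A) (0# 1# : A)
                               : Set (a ⊔ ℓ) where
    -- Not Relation.Binary.Construct.NaturalOrder: its orders (x ≈ x + y and
    -- x ≈ y + x) read + as a meet, whereas here + is a join.
    _≤_ : Rel A ℓ
    x ≤ y = (x + y) ≈ y

    field
      isIdempotentSemiring : IsIdempotentSemiring _+_ _·_ 0# 1#
      α-cong               : Congruent₁ α
      α-involutive         : Involutive α
      α-antitone           : Antitonic₁ _≤_ _≤_ α
      α-·                  : ∀ x y →
        (α (x · α y) · α y) ≈ (α (y · α x) · α x)

    open IsIdempotentSemiring isIdempotentSemiring public

record MVAlgebra c ℓ : Set (suc (c ⊔ ℓ)) where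
  infix  8 _′
  infixl 6 _⊕_
  infix  4 _≈_
  field
    Carrier     : Set c
    _≈_         : Rel Carrier ℓ
    _⊕_         : Op₂ Carrier
    _′          : Op₁ Carrier
    0#          : Carrier
    isMVAlgebra : IsMVAlgebra _≈_ _⊕_ _′ 0#

  open IsMVAlgebra isMVAlgebra public

module R {c ℓ} (M : MVAlgebra c ℓ) where

  open MVAlgebra M public using (Carrier; _≈_; 0#)
  open MVAlgebra M using (_⊕_; _′)

  infixl 7 _·_
  infixl 6 _+_

  _+_ : Op₂ Carrier
  x + y = (x ′ ⊕ y) ′ ⊕ y

  _·_ : Op₂ Carrier
  x · y = (x ′ ⊕ y ′) ′

  α : Op₁ Carrier
  α x = x ′

  1# : Carrier
  1# = 0# ′

{-# OPTIONS --safe #-}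
-- The relation x ≤ y :⇔ x ′ ⊕ y ≈ 1 is a partial order for which + is the join
-- and 0 the least element, so the laws of + are those of a bounded join
-- semilattice.  Multiplication is the De Morgan dual of ⊕, which makes it a
-- commutative monoid, and x · y ≤ z iff y ≤ x ′ ⊕ z; hence x · – is a left
-- adjoint and preserves joins, which is distributivity.
module Submission where

open import Defs
import Algebra.Consequences.Setoid as Consequences
open import Data.Product.Base using (_,_)
open import Relation.Binary.Core using (Rel)
open import Relation.Binary.Definitions
  using (Reflexive; Transitive; Antisymmetric; Minimum; Antitonic₁)
open import Relation.Binary.Structures using (IsPartialOrder)
open import Relation.Binary.Lattice
  using (BoundedJoinSemilattice; Supremum)
import Relation.Binary.Lattice.Properties.BoundedJoinSemilattice
  as BoundedJoinSemilatticeProperties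
import Relation.Binary.Lattice.Properties.JoinSemilattice
  as JoinSemilatticeProperties
import Relation.Binary.Reasoning.Setoid as SetoidReasoning

module _ {c ℓ} (M : MVAlgebra c ℓ) where

  open R M
  open MVAlgebra M hiding (Carrier; _≈_; 0#)
  open SetoidReasoning setoid
  open Consequences setoid
    using (comm∧idˡ⇒id; comm∧zeʳ⇒ze; comm∧distrˡ⇒distr)
  open import Algebra.Definitions _≈_
  open import Algebra.Structures _≈_

  infix 4 _≤_

  -- `x ′ ⊕ y` is Łukasiewicz implication; the relation says that it takes the value `1#`.
  _≤_ : Rel Carrier ℓ
  x ≤ y = x ′ ⊕ y ≈ 1#

  1′⊕ : ∀ x → 1# ′ ⊕ x ≈ x
  1′⊕ x = begin
    1# ′ ⊕ x  ≈⟨ ∙-congʳ (′-involutive 0#) ⟩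
    0# ⊕ x    ≈⟨ identityˡ x ⟩
    x         ∎

  -- An instance of `łukasiewicz` with `1#` as one argument: one side collapses because `1# ′` is
  -- neutral, the other because `1#` absorbs.
  ≤-refl : Reflexive _≤_
  ≤-refl {x} = begin
    x ′ ⊕ x              ≈⟨ ∙-congʳ (′-cong (1′⊕ x)) ⟨
    (1# ′ ⊕ x) ′ ⊕ x     ≈⟨ łukasiewicz 1# x ⟩
    (x ′ ⊕ 1#) ′ ⊕ 1#    ≈⟨ ⊕-zeroʳ _ ⟩
    1#                   ∎

  ≤-respʳ-≈ : ∀ {x y z} → y ≈ z → x ≤ y → x ≤ z
  ≤-respʳ-≈ y≈z x≤y = trans (∙-congˡ (sym y≈z)) x≤y

  -- The main source of inequalities below: to bound `x` by some element, exhibit that element as a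
  -- sum with summand `x`.
  x≤y⊕x : ∀ x y → x ≤ y ⊕ x
  x≤y⊕x x y = begin
    x ′ ⊕ (y ⊕ x)  ≈⟨ ∙-congˡ (comm y x) ⟩
    x ′ ⊕ (x ⊕ y)  ≈⟨ assoc (x ′) x y ⟨
    x ′ ⊕ x ⊕ y    ≈⟨ ∙-congʳ ≤-refl ⟩
    1# ⊕ y         ≈⟨ comm 1# y ⟩
    y ⊕ 1#         ≈⟨ ⊕-zeroʳ y ⟩
    1#             ∎

  x≤y⇒x+y≈y : ∀ {x y} → x ≤ y → x + y ≈ y
  x≤y⇒x+y≈y x≤y = trans (∙-congʳ (′-cong x≤y)) (1′⊕ _)

  -- By its definition a join shows only its right argument as a summand; `łukasiewicz` swaps the
  -- arguments and so exposes `x`.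
  x≤x+y : ∀ x y → x ≤ x + y
  x≤x+y x y = ≤-respʳ-≈ (łukasiewicz y x) (x≤y⊕x x _)

  y≤x+y : ∀ x y → y ≤ x + y
  y≤x+y x y = x≤y⊕x y _

  ′-antitone : Antitonic₁ _≤_ _≤_ _′
  ′-antitone {x} {y} y≤x = begin
    x ′ ′ ⊕ y ′  ≈⟨ ∙-congʳ (′-involutive x) ⟩
    x ⊕ y ′      ≈⟨ comm x (y ′) ⟩
    y ′ ⊕ x      ≈⟨ y≤x ⟩
    1#           ∎

  -- x ≤ y gives y ≈ y + x = (y ′ ⊕ x) ′ ⊕ x, a sum with summand x.
  ⊕-monoˡ-≤ : ∀ z {x y} → x ≤ y → x ⊕ z ≤ y ⊕ z
  ⊕-monoˡ-≤ z {x} {y} x≤y = ≤-respʳ-≈ (begin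
    (y ′ ⊕ x) ′ ⊕ (x ⊕ z)  ≈⟨ assoc _ x z ⟨
    y + x ⊕ z              ≈⟨ ∙-congʳ (łukasiewicz y x) ⟩
    x + y ⊕ z              ≈⟨ ∙-congʳ (x≤y⇒x+y≈y x≤y) ⟩
    y ⊕ z                  ∎) (x≤y⊕x (x ⊕ z) _)

  -- Adding `x ′` to both sides of `y ≤ z` gives `y ⊕ x ′ ≤ z ⊕ x ′`. By `x ≤ y` the left side is
  -- `1#`, which forces the right side to be `1#` too.
  ≤-trans : Transitive _≤_
  ≤-trans {x} {y} {z} x≤y y≤z = begin
    x ′ ⊕ z                  ≈⟨ 1′⊕ _ ⟨
    1# ′ ⊕ (x ′ ⊕ z)         ≈⟨ ∙-cong (′-cong (trans (comm y (x ′)) x≤y)) (comm z (x ′)) ⟨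
    (y ⊕ x ′) ′ ⊕ (z ⊕ x ′)  ≈⟨ ⊕-monoˡ-≤ (x ′) y≤z ⟩
    1#                       ∎

  ≤-antisym : Antisymmetric _≈_ _≤_
  ≤-antisym {x} {y} x≤y y≤x = begin
    x      ≈⟨ x≤y⇒x+y≈y y≤x ⟨
    y + x  ≈⟨ łukasiewicz y x ⟩
    x + y  ≈⟨ x≤y⇒x+y≈y x≤y ⟩
    y      ∎

  ≤-isPartialOrder : IsPartialOrder _≈_ _≤_
  ≤-isPartialOrder = record
    { isPreorder = record
      { isEquivalence = isEquivalence
      ; reflexive     = λ x≈y → ≤-respʳ-≈ x≈y ≤-refl
      ; trans         = ≤-trans
      }
    ; antisym = ≤-antisym
    }

  -- + is monotone in its left argument, so x + y ≤ z + y ≈ z.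
  +-least : ∀ {x y z} → x ≤ z → y ≤ z → x + y ≤ z
  +-least {x} {y} {z} x≤z y≤z = ≤-respʳ-≈
    (trans (łukasiewicz z y) (x≤y⇒x+y≈y y≤z))
    (⊕-monoˡ-≤ y (′-antitone (⊕-monoˡ-≤ y (′-antitone x≤z))))

  +-supremum : Supremum _≤_ _+_
  +-supremum x y = x≤x+y x y , y≤x+y x y , λ _ → +-least

  0-minimum : Minimum _≤_ 0#
  0-minimum x = trans (comm 1# x) (⊕-zeroʳ x)

  boundedJoinSemilattice : BoundedJoinSemilattice c ℓ ℓ
  boundedJoinSemilattice = record
    { isBoundedJoinSemilattice = record
      { isJoinSemilattice = record
        { isPartialOrder = ≤-isPartialOrder
        ; supremum       = +-supremum
        }
      ; minimum = 0-minimum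
      }
    }

  open BoundedJoinSemilatticeProperties boundedJoinSemilattice
    using () renaming (identity to +-identity)
  open JoinSemilatticeProperties
    (BoundedJoinSemilattice.joinSemilattice boundedJoinSemilattice)
    using (∨-cong; ∨-comm; ∨-assoc; ∨-idempotent)

  +-isCommutativeMonoid : IsCommutativeMonoid _+_ 0#
  +-isCommutativeMonoid = record
    { isMonoid = record
      { isSemigroup = record
        { isMagma = record { isEquivalence = isEquivalence ; ∙-cong = ∨-cong }
        ; assoc   = ∨-assoc
        }
      ; identity = +-identity
      }
    ; comm = ∨-comm
    }

  ·-cong : Congruent₂ _·_
  ·-cong x≈y u≈v = ′-cong (∙-cong (′-cong x≈y) (′-cong u≈v))

  ·-comm : Commutative _·_
  ·-comm x y = ′-cong (comm (x ′) (y ′))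

  ·-assoc : Associative _·_
  ·-assoc x y z = ′-cong (begin
    (x ′ ⊕ y ′) ′ ′ ⊕ z ′  ≈⟨ ∙-congʳ (′-involutive _) ⟩
    x ′ ⊕ y ′ ⊕ z ′        ≈⟨ assoc (x ′) (y ′) (z ′) ⟩
    x ′ ⊕ (y ′ ⊕ z ′)      ≈⟨ ∙-congˡ (′-involutive _) ⟨
    x ′ ⊕ (y ′ ⊕ z ′) ′ ′  ∎)

  ·-identityˡ : LeftIdentity 1# _·_
  ·-identityˡ x = trans (′-cong (1′⊕ (x ′))) (′-involutive x)

  ·-zeroʳ : RightZero 0# _·_
  ·-zeroʳ x = trans (′-cong (⊕-zeroʳ (x ′))) (′-involutive 0#)

  -- Currying for implication. Since the order is an equation with `1#`, both directions of the
  -- adjunction follow by transitivity of `≈`.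
  ·-⊕-residual : ∀ x y z → (x · y) ′ ⊕ z ≈ y ′ ⊕ (x ′ ⊕ z)
  ·-⊕-residual x y z = begin
    (x · y) ′ ⊕ z      ≈⟨ ∙-congʳ (′-involutive _) ⟩
    x ′ ⊕ y ′ ⊕ z      ≈⟨ ∙-congʳ (comm (x ′) (y ′)) ⟩
    y ′ ⊕ x ′ ⊕ z      ≈⟨ assoc (y ′) (x ′) z ⟩
    y ′ ⊕ (x ′ ⊕ z)    ∎

  x·y≤z⇒y≤x′⊕z : ∀ {x y z} → x · y ≤ z → y ≤ x ′ ⊕ z
  x·y≤z⇒y≤x′⊕z = trans (sym (·-⊕-residual _ _ _))

  y≤x′⊕z⇒x·y≤z : ∀ {x y z} → y ≤ x ′ ⊕ z → x · y ≤ z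
  y≤x′⊕z⇒x·y≤z = trans (·-⊕-residual _ _ _)

  ·-monoʳ-≤ : ∀ x {y z} → y ≤ z → x · y ≤ x · z
  -- Transposing `x · z ≤ x · z` yields the unit `z ≤ x ′ ⊕ x · z`.
  ·-monoʳ-≤ x y≤z = y≤x′⊕z⇒x·y≤z (≤-trans y≤z (x·y≤z⇒y≤x′⊕z ≤-refl))

  ·-distribˡ-+ : _·_ DistributesOverˡ _+_
  ·-distribˡ-+ x y z = ≤-antisym
    -- Transposing `x` to the right leaves the join `y + z` alone on the left, where leastness
    -- applies.
    (y≤x′⊕z⇒x·y≤z (+-least (x·y≤z⇒y≤x′⊕z (x≤x+y (x · y) (x · z)))
                           (x·y≤z⇒y≤x′⊕z (y≤x+y (x · y) (x · z)))))
    (+-least (·-monoʳ-≤ x (x≤x+y y z)) (·-monoʳ-≤ x (y≤x+y y z)))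

  +-·-isIdempotentSemiring : IsIdempotentSemiring _+_ _·_ 0# 1#
  +-·-isIdempotentSemiring = record
    { isSemiring = record
      { isSemiringWithoutAnnihilatingZero = record
        { +-isCommutativeMonoid = +-isCommutativeMonoid
        ; *-cong                = ·-cong
        ; *-assoc               = ·-assoc
        ; *-identity            = comm∧idˡ⇒id ·-comm ·-identityˡ
        ; distrib               = comm∧distrˡ⇒distr ∨-cong ·-comm ·-distribˡ-+
        }
      ; zero = comm∧zeʳ⇒ze ·-comm ·-zeroʳ
      }
    ; +-idem = ∨-idempotent
    }

  -- With `x≤y⇒x+y≈y` this identifies the order of the semiring with `≤`, so that antitonicity of
  -- the complement carries over.
  x+y≈y⇒x≤y : ∀ {x y} → x + y ≈ y → x ≤ y
  x+y≈y⇒x≤y {x} {y} x+y≈y = ≤-respʳ-≈ x+y≈y (x≤x+y x y)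

  -- Only double complements need cancelling. The last axiom of a Łukasiewicz semiring thereby
  -- becomes commutativity of the join.
  α[x·αy]·αy≈[x+y]′ : ∀ x y → α (x · α y) · α y ≈ (x + y) ′
  α[x·αy]·αy≈[x+y]′ x y = ′-cong (∙-cong
    (′-cong (trans (′-involutive _) (∙-congˡ (′-involutive y))))
    (′-involutive y))

  α-·-comm : ∀ x y → α (x · α y) · α y ≈ α (y · α x) · α x
  α-·-comm x y = begin
    α (x · α y) · α y  ≈⟨ α[x·αy]·αy≈[x+y]′ x y ⟩
    (x + y) ′          ≈⟨ ′-cong (łukasiewicz x y) ⟩
    (y + x) ′          ≈⟨ α[x·αy]·αy≈[x+y]′ y x ⟨
    α (y · α x) · α x  ∎

corollary3 : ∀ {c ℓ} (M : MVAlgebra c ℓ) →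
    let open R M in IsŁukasiewiczSemiring _≈_ _+_ _·_ α 0# 1#
corollary3 M = record
  { isIdempotentSemiring = +-·-isIdempotentSemiring M
  ; α-cong               = MVAlgebra.′-cong M
  ; α-involutive         = MVAlgebra.′-involutive M
  ; α-antitone           = λ y+x≈x →
      x≤y⇒x+y≈y M (′-antitone M (x+y≈y⇒x≤y M y+x≈x))
  ; α-·                  = α-·-comm M
  }
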